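{- Let $R$ be an order in a quadratic number field. Then $R$ is super-multiplicative: for every pair of non-zero ideals $I,J$ of $R$ one has $N(IJ)\geq N(I)N(J)$.
   Context: An order in a number field $K$ is a subring of $K$ with fraction field $K$ whose additive group is finitely generated; a quadratic number field is a number field of degree $2$ over $\mathbb{Q}$. For a non-zero ideal $I$ of $R$, $N(I)=[R:I]$ is its index as an additive subgroup. A ring is super-multiplicative if for all ideals $I,J$ with $[R:IJ]$ finite one has $N(IJ)\geq N(I)N(J)$. -}

module Defs where

open import Algebra.Apartness.Bundles using (HeytingField)
open import Algebra.Bundles using (Group; RawRing; CommutativeRing)
import Algebra.Definitions.RawMonoid as RawMonoidDefinitions
import Algebra.Morphism.RingMonomorphism as RingMonomorphism
open import Algebra.Morphism.Structures using (IsRingHomomorphism; IsRingMonomorphism)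
import Algebra.Properties.AbelianGroup as AbelianGroupProperties
import Algebra.Properties.Ring as RingProperties
open import Data.Fin.Base using (Fin)
open import Data.Nat.Base as ℕ using (ℕ)
open import Data.Product.Base using (Σ; Σ-syntax; ∃-syntax; _×_; _,_; proj₁; proj₂)
open import Data.Rational.Base using (ℚ; 0ℚ; +-*-rawRing)
open import Data.Vec.Functional using (Vector)
open import Function.Bundles using (Inverse)
open import Level using (Level; _⊔_; suc)
open import Relation.Binary.Bundles using (Setoid)
open import Relation.Binary.PropositionalEquality as ≡ using (_≡_)
open import Relation.Nullary.Negation using (¬_)
open import Relation.Unary using (Pred; _∈_; _⊆_)

private
  variable
    c ℓ ℓ′ p i j : Level

module _ (G : Group c ℓ) where

  open Group G

  data Generated (S : Pred Carrier p) : Pred Carrier (c ⊔ ℓ ⊔ p) where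
    gen  : ∀ {x} → x ∈ S → x ∈ Generated S
    unit : ε ∈ Generated S
    mult : ∀ {x y} → x ∈ Generated S → y ∈ Generated S → x ∙ y ∈ Generated S
    inv  : ∀ {x} → x ∈ Generated S → x ⁻¹ ∈ Generated S
    resp : ∀ {x y} → x ≈ y → x ∈ Generated S → y ∈ Generated S

  FinitelyGenerated : Set (c ⊔ ℓ)
  FinitelyGenerated =
    ∃[ n ] Σ[ g ∈ Vector Carrier n ] (∀ x → x ∈ Generated (λ y → ∃[ k ] y ≈ g k))

module _ (R : CommutativeRing c ℓ) where

  open CommutativeRing R

  record Ideal i : Set (c ⊔ ℓ ⊔ suc i) where
    field
      member   : Pred Carrier i
      ∈-resp-≈ : ∀ {x y} → x ≈ y → x ∈ member → y ∈ member
      0∈       : 0# ∈ member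
      +-closed : ∀ {x y} → x ∈ member → y ∈ member → x + y ∈ member
      *-absorb : ∀ r {x} → x ∈ member → r * x ∈ member

module _ {R : CommutativeRing c ℓ} where

  open CommutativeRing R
  open Ideal

  NonZeroIdeal : Ideal R i → Set (c ⊔ ℓ ⊔ i)
  NonZeroIdeal I = ¬ (member I ⊆ (_≈ 0#))

  infixl 7 _·_

  -- The ideal product: the additive subgroup generated by the products x * y.
  _·_ : Ideal R i → Ideal R j → Ideal R (c ⊔ ℓ ⊔ i ⊔ j)
  I · J = record
    { member   = Generated +-group Products
    ; ∈-resp-≈ = resp
    ; 0∈       = unit
    ; +-closed = mult
    ; *-absorb = absorb
    }
    where
    open RingProperties ring using (-‿distribʳ-*)

    Products : Pred Carrier _
    Products z = ∃[ x ] ∃[ y ] (x ∈ member I × y ∈ member J × z ≈ x * y)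

    absorb : ∀ r {x} → x ∈ Generated +-group Products → r * x ∈ Generated +-group Products
    absorb r (gen (x , y , x∈I , y∈J , z≈xy)) =
      gen (r * x , y , *-absorb I r x∈I , y∈J , trans (*-congˡ z≈xy) (sym (*-assoc r x y)))
    absorb r unit           = resp (sym (zeroʳ r)) unit
    absorb r (mult u v)     = resp (sym (distribˡ r _ _)) (mult (absorb r u) (absorb r v))
    absorb r (inv u)        = resp (-‿distribʳ-* r _) (inv (absorb r u))
    absorb r (resp x≈y u)   = resp (*-congˡ x≈y) (absorb r u)

  Quotient : Ideal R i → Setoid c i
  Quotient I = record
    { Carrier       = Carrier
    ; _≈_           = λ x y → x - y ∈ member I
    ; isEquivalence = record
      { refl  = λ {x} → ∈-resp-≈ I (sym (-‿inverseʳ x)) (0∈ I)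
      ; sym   = λ {x} {y} u → ∈-resp-≈ I (flip x y) (*-absorb I (- 1#) u)
      ; trans = λ {x} {y} {z} u v → ∈-resp-≈ I (telescope x y z) (+-closed I u v)
      }
    }
    where
    open RingProperties ring using (-1*x≈-x)
    open AbelianGroupProperties +-abelianGroup using (⁻¹-anti-homo‿-)

    flip : ∀ x y → - 1# * (x - y) ≈ y - x
    flip x y = trans (-1*x≈-x (x - y)) (⁻¹-anti-homo‿- x y)

    telescope : ∀ x y z → (x - y) + (y - z) ≈ x - z
    telescope x y z =
      trans (+-assoc x (- y) (y - z))
        (+-congˡ (trans (sym (+-assoc (- y) y (- z)))
          (trans (+-congʳ (-‿inverseˡ y)) (+-identityˡ (- z)))))

  -- The norm as a relation: HasIndex I n says N(I) = [R : I] = n.  An arbitrary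
  -- ideal need not have decidable membership, so N(I) cannot be a function here.
  HasIndex : Ideal R i → ℕ → Set (c ⊔ i)
  HasIndex I n = Inverse (Quotient I) (≡.setoid (Fin n))

  FiniteIndex : Ideal R i → Set (c ⊔ i)
  FiniteIndex I = ∃[ n ] HasIndex I n

  -- N(I · J) ≥ N(I) N(J).  The three norms exist as natural numbers in the
  -- double-negated sense (equivalent to plain existence classically), and their
  -- values satisfy the inequality.
  record NormInequality (I : Ideal R i) (J : Ideal R j) : Set (c ⊔ ℓ ⊔ i ⊔ j) where
    field
      finiteˡ : ¬ ¬ FiniteIndex I
      finiteʳ : ¬ ¬ FiniteIndex J
      finite· : ¬ ¬ FiniteIndex (I · J)
      bound   : ∀ {l m n} → HasIndex I l → HasIndex J m → HasIndex (I · J) n →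
                n ℕ.≥ l ℕ.* m

SuperMultiplicative : CommutativeRing c ℓ → ∀ i j → Set (c ⊔ ℓ ⊔ suc (i ⊔ j))
SuperMultiplicative R i j =
  ∀ (I : Ideal R i) (J : Ideal R j) → FiniteIndex (I · J) → NormInequality I J

record NumberField (degree : ℕ) c ℓ ℓ′ : Set (suc (c ⊔ ℓ ⊔ ℓ′)) where
  field
    heytingField : HeytingField c ℓ ℓ′

  open HeytingField heytingField public

  commutativeRing : CommutativeRing c ℓ
  commutativeRing = record { isCommutativeRing = isCommutativeRing }

  open CommutativeRing commutativeRing public using (rawRing; +-rawMonoid)
  open RawMonoidDefinitions +-rawMonoid using (sum)

  field
    fromℚ                : ℚ → Carrier
    fromℚ-isHomomorphism : IsRingHomomorphism +-*-rawRing rawRing fromℚ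

  combination : Vector ℚ degree → Vector Carrier degree → Carrier
  combination q b = sum (λ k → fromℚ (q k) * b k)

  field
    basis       : Vector Carrier degree
    spanning    : ∀ x → ∃[ q ] x ≈ combination q basis
    independent : ∀ q → combination q basis ≈ 0# → ∀ k → q k ≡ 0ℚ

QuadraticField : ∀ c ℓ ℓ′ → Set (suc (c ⊔ ℓ ⊔ ℓ′))
QuadraticField = NumberField 2

module _ (R : CommutativeRing c ℓ) where

  open CommutativeRing R

  record Subring p : Set (c ⊔ ℓ ⊔ suc p) where
    field
      member   : Pred Carrier p
      ∈-resp-≈ : ∀ {x y} → x ≈ y → x ∈ member → y ∈ member
      0∈       : 0# ∈ member
      1∈       : 1# ∈ member
      +-closed : ∀ {x y} → x ∈ member → y ∈ member → x + y ∈ member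
      *-closed : ∀ {x y} → x ∈ member → y ∈ member → x * y ∈ member
      -‿closed : ∀ {x} → x ∈ member → - x ∈ member

    subRawRing : RawRing (c ⊔ p) ℓ
    subRawRing = record
      { Carrier = Σ Carrier member
      ; _≈_     = λ x y → proj₁ x ≈ proj₁ y
      ; _+_     = λ (x , x∈) (y , y∈) → x + y , +-closed x∈ y∈
      ; _*_     = λ (x , x∈) (y , y∈) → x * y , *-closed x∈ y∈
      ; -_      = λ (x , x∈) → - x , -‿closed x∈
      ; 0#      = 0# , 0∈
      ; 1#      = 1# , 1∈
      }

    inclusion-isMonomorphism : IsRingMonomorphism subRawRing rawRing proj₁
    inclusion-isMonomorphism = record
      { isRingHomomorphism = record
        { isSemiringHomomorphism = record
          { isNearSemiringHomomorphism = record
            { +-isMonoidHomomorphism = record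
              { isMagmaHomomorphism = record
                { isRelHomomorphism = record { cong = λ x≈y → x≈y }
                ; homo              = λ _ _ → refl
                }
              ; ε-homo = refl
              }
            ; *-homo = λ _ _ → refl
            }
          ; 1#-homo = refl
          }
        ; -‿homo = λ _ → refl
        }
      ; injective = λ x≈y → x≈y
      }

    subCommutativeRing : CommutativeRing (c ⊔ p) ℓ
    subCommutativeRing = record
      { isCommutativeRing =
          RingMonomorphism.isCommutativeRing inclusion-isMonomorphism isCommutativeRing
      }

record Order {degree} (K : NumberField degree c ℓ ℓ′) p : Set (c ⊔ ℓ ⊔ ℓ′ ⊔ suc p) where
  open NumberField K
  field
    subring : Subring commutativeRing p

  open Subring subring public

  orderRing : CommutativeRing (c ⊔ p) ℓ
  orderRing = subCommutativeRing

  field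
    finitelyGenerated : FinitelyGenerated (CommutativeRing.+-group orderRing)
    fractions         : ∀ z → ∃[ x ] ∃[ y ] (x ∈ member × y ∈ member × y # 0# × z * y ≈ x)

{-# OPTIONS --safe #-}
module Submission where

-- Write R = ℤ ⊕ ℤ ω and let det be the determinant of two elements in the basis 1, ω.  It is the
-- ω-coordinate of (conj α) β, and for α, β in an ideal I both det (α, β) and det (α, ω β) are
-- divisible by N(I), so that (conj α) β lies in N(I) R.  Hence, for α, β in I and y, z in J,
-- det (α y, β z) is the ω-coordinate of (conj α) β (conj y) z, an element of N(I) N(J) R.  By
-- bilinearity N(I) N(J) divides det on all of I J, and so divides N(I J), which is the
-- determinant of a basis of I J.  Undecidable membership is no obstacle: the bases exist in the
-- double-negated sense, and the inequality is decidable.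

open import Defs
open import Algebra.Bundles using (CommutativeRing)
open import Algebra.Morphism.Construct.Composition using (isRingHomomorphism)
open import Algebra.Morphism.Structures using (IsRingHomomorphism)
import Algebra.Properties.Ring as RingProperties
import Algebra.Solver.Ring as Solver
open import Algebra.Solver.Ring.AlmostCommutativeRing using (fromCommutativeRing; _-Raw-AlmostCommutative⟶_)
open import Data.Empty using (⊥-elim)
open import Data.Fin.Base using (Fin; zero; suc; toℕ; fromℕ<; combine; remQuot)
open import Data.Fin.Properties as Fin
  using (toℕ<n; toℕ-fromℕ<; toℕ-injective; combine-remQuot; remQuot-combine; pigeonhole)
open import Data.Fin.Permutation using (↔⇒≡)
open import Data.Integer.Base as ℤ using (ℤ; +_; -[1+_]; 0ℤ; 1ℤ; _+_; _*_; _-_; -_; ∣_∣; _%ℕ_; _/ℕ_)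
open import Data.Integer.DivMod using (n%ℕd<d; a≡a%ℕn+[a/ℕn]*n)
open import Data.Integer.Divisibility.Signed
  using (_∣_; divides; ∣⇒∣ᵤ; ∣m∣n⇒∣m+n; ∣m∣n⇒∣m-n; ∣m⇒∣-m; ∣n⇒∣m*n)
import Data.Integer.Properties as ℤ
open import Data.Integer.Tactic.RingSolver using (solve-∀)
open import Data.Maybe.Base using (Maybe; map)
open import Data.Nat.Base as ℕ using (ℕ; zero; suc; _<_)
import Data.Nat.Divisibility as ℕ∣
open import Data.Nat.Induction using (<-rec)
import Data.Nat.Properties as ℕ
open import Data.Product.Base using (∃-syntax; ∃₂; _×_; _,_; proj₁; proj₂; uncurry)
open import Data.Rational.Base as ℚ using (ℚ; 0ℚ)
import Data.Rational.Properties as ℚ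
open import Data.Rational.Unnormalised.Base as ℚᵘ using (mkℚᵘ; *≡*)
import Data.Rational.Unnormalised.Properties as ℚᵘ
open import Data.Sum.Base using (_⊎_; inj₁; inj₂)
open import Function.Base using (_∘_)
open import Function.Bundles using (Inverse)
open import Function.Construct.Composition using (inverse)
open import Function.Construct.Symmetry using () renaming (inverse to symmetric)
open import Level using (Level; _⊔_)
open import Relation.Binary.Bundles using (Setoid)
open import Relation.Binary.PropositionalEquality as ≡ using (_≡_; _≢_; cong; cong₂; subst; subst₂)
import Relation.Binary.Reasoning.Setoid as SetoidReasoning
open import Relation.Nullary.Decidable using (Dec; yes; no; decidable-stable; dec⇒maybe)
open import Relation.Nullary.Negation using (¬_)
open import Relation.Unary using (Pred)

-- Ideals of a non-maximal order need not be invertible, so `N` need not be multiplicative and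
-- unique factorisation is not at hand; determinants replace both. Two elements of `I` span a
-- sublattice of `I`, so their determinant is a multiple of the index. Conjugation is what separates
-- the factors: conj (α y) = (conj α) (conj y), so a determinant of two products is a coordinate of
-- a product of two elements, one depending on `I` alone and the other on `J` alone. The
-- decomposition R = ℤ ⊕ ℤ ω has to be earned from finite generation and the fraction property.
-- Finite generation bounds the denominators over a rational basis 1, r with r in R, so R becomes a
-- lattice in ℤ² and the same Hermite reduction serves for R and for its ideals. That reduction
-- picks minimal elements of sets that need not be decidable, hence the double negations.

private
  variable
    c ℓ ℓ′ p ℓ₁ ℓ₂ : Level

-- If no least element existed, well-founded induction would refute `P` at every number. `P` need
-- not be decidable, so no search could produce the minimum outright.
¬¬-least : (P : ℕ → Set p) → ∀ {n} → P n → ¬ ¬ (∃[ m ] P m × (∀ {k} → k < m → ¬ P k))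
¬¬-least P Pn k = <-rec (λ n → ¬ P n) (λ n below Pn → k (n , Pn , below)) _ Pn

-- The absolute difference is at most the larger of the two, hence below `d`, and the only multiple
-- of `d` that small is 0.
diff<∧∣⇒≡ : ∀ {m n d} → m < d → n < d → + d ∣ + m - + n → m ≡ n
diff<∧∣⇒≡ {m} {n} {d} m<d n<d d∣ =
  ℤ.+-injective (ℤ.i-j≡0⇒i≡j (+ m) (+ n) (ℤ.∣i∣≡0⇒i≡0 (small small<d (∣⇒∣ᵤ d∣))))
  where
  small : ∀ {k d} → k < d → d ℕ∣.∣ k → k ≡ 0
  small {zero}  k<d d∣k = ≡.refl
  small {suc k} k<d d∣k = ⊥-elim (ℕ.<⇒≱ k<d (ℕ∣.∣⇒≤ d∣k))

  small<d : ∣ + m - + n ∣ < d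
  small<d = ℕ.≤-<-trans
    (ℕ.≤-trans (ℕ.≤-reflexive (cong ∣_∣ (ℤ.m-n≡m⊖n m n))) (ℤ.∣m⊝n∣≤m⊔n m n))
    (ℕ.⊔-lub m<d n<d)

*-≢0 : ∀ {x y} → x ≢ 0ℤ → y ≢ 0ℤ → x * y ≢ 0ℤ
*-≢0 {x} x≢0 y≢0 xy≡0 with ℤ.i*j≡0⇒i≡0∨j≡0 x xy≡0
... | inj₁ x≡0 = x≢0 x≡0
... | inj₂ y≡0 = y≢0 y≡0

*-cancel-≢0 : ∀ {x y} → x ≢ 0ℤ → x * y ≡ 0ℤ → y ≡ 0ℤ
*-cancel-≢0 {x} x≢0 xy≡0 with ℤ.i*j≡0⇒i≡0∨j≡0 x xy≡0
... | inj₁ x≡0 = ⊥-elim (x≢0 x≡0)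
... | inj₂ y≡0 = y≡0

det : ℤ → ℤ → ℤ → ℤ → ℤ
det x y x′ y′ = x * y′ - y * x′

-- Lattices in ℤ²

-- Zero and differences already yield negatives, sums and integer multiples. Full rank enters only
-- at `hermiteBasis`, through the multiples `N` of the two unit vectors.
record IsLattice (L : ℤ → ℤ → Set p) : Set p where
  field
    0-mem    : L 0ℤ 0ℤ
    -‿closed : ∀ {x y x′ y′} → L x y → L x′ y′ → L (x - x′) (y - y′)

  neg : ∀ {x y} → L x y → L (- x) (- y)
  neg u = subst₂ L (ℤ.+-identityˡ _) (ℤ.+-identityˡ _) (-‿closed 0-mem u)

  add : ∀ {x y x′ y′} → L x y → L x′ y′ → L (x + x′) (y + y′)
  add {x} {y} {x′} {y′} u v = subst₂ L (cancel x x′) (cancel y y′) (-‿closed u (neg v))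
    where
    cancel : ∀ a b → a - (- b) ≡ a + b
    cancel = solve-∀

  scaleℕ : ∀ n {x y} → L x y → L (+ n * x) (+ n * y)
  scaleℕ zero {x} {y}    u = subst₂ L (≡.sym (ℤ.*-zeroˡ x)) (≡.sym (ℤ.*-zeroˡ y)) 0-mem
  scaleℕ (suc n) {x} {y} u =
    subst₂ L (≡.sym (ℤ.suc-* (+ n) x)) (≡.sym (ℤ.suc-* (+ n) y)) (add u (scaleℕ n u))

  scale : ∀ k {x y} → L x y → L (k * x) (k * y)
  scale (+ n)    u = scaleℕ n u
  scale -[1+ n ] {x} {y} u = subst₂ L (ℤ.neg-distribˡ-* (+ suc n) x) (ℤ.neg-distribˡ-* (+ suc n) y)
    (neg (scaleℕ (suc n) u))

  abs₁ : ∀ z → L z 0ℤ → L (+ ∣ z ∣) 0ℤ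
  abs₁ (+ n)    u = u
  abs₁ -[1+ n ] u = neg u

  abs₂ : ∀ z → L 0ℤ z → L 0ℤ (+ ∣ z ∣)
  abs₂ (+ n)    u = u
  abs₂ -[1+ n ] u = neg u

-- A triangular basis in the style of the Hermite normal form, with `b` left unreduced modulo `a`.
-- Its determinant `a d` is the index of `L` in ℤ².
record HermiteBasis (L : ℤ → ℤ → Set p) : Set p where
  field
    a d      : ℕ
    b        : ℤ
    {{a≢0}}  : ℕ.NonZero a
    {{d≢0}}  : ℕ.NonZero d
    first    : L (+ a) 0ℤ
    second   : L b (+ d)
    expand   : ∀ {x y} → L x y → ∃₂ λ i j → x ≡ i * + a + j * b × y ≡ j * + d

  -- The determinant is multiplicative: the quotient is the determinant of the matrix of
  -- coefficients in the basis.
  ∣det : ∀ {x y x′ y′} → L x y → L x′ y′ → + a * + d ∣ det x y x′ y′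
  ∣det u v with expand u | expand v
  ... | i , j , ≡.refl , ≡.refl | i′ , j′ , ≡.refl , ≡.refl =
    divides (i * j′ - j * i′) (identity i j i′ j′ (+ a) b (+ d))
    where
    identity : ∀ i j i′ j′ a b d →
      (i * a + j * b) * (j′ * d) - (j * d) * (i′ * a + j′ * b) ≡ (i * j′ - j * i′) * (a * d)
    identity = solve-∀

module _ {L : ℤ → ℤ → Set p} (isLattice : IsLattice L) where

  open IsLattice isLattice

  -- `a` is the least positive integer on the first axis and `d` the least positive second
  -- coordinate; the two multiples of unit vectors show that candidates exist. Minimality forces
  -- every remainder of a division by `a` or `d` to vanish.
  hermiteBasis : ∀ {N} → N ≢ 0ℤ → L N 0ℤ → L 0ℤ N → ¬ ¬ HermiteBasis L
  hermiteBasis {N} N≢0 Ne₁ Ne₂ k =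
    ¬¬-least P (N≢0′ , abs₁ N Ne₁) λ (a , (a≢0 , first) , a-least) →
    ¬¬-least Q (N≢0′ , 0ℤ , abs₂ N Ne₂) λ (d , (d≢0 , b , second) , d-least) →
    k (basis a≢0 first a-least d≢0 second d-least)
    where
    P Q : ℕ → Set _
    P n = ℕ.NonZero n × L (+ n) 0ℤ
    Q n = ℕ.NonZero n × (∃[ b ] L b (+ n))

    N≢0′ : ℕ.NonZero ∣ N ∣
    N≢0′ = ℕ.≢-nonZero (N≢0 ∘ ℤ.∣i∣≡0⇒i≡0)

    least⇒0 : {S : ℕ → Set p} → ∀ {m r} → (∀ {k} → k < m → ¬ (ℕ.NonZero k × S k)) → r < m → S r → r ≡ 0
    least⇒0 {r = zero}  least r<m Sr = ≡.refl
    least⇒0 {r = suc r} least r<m Sr = ⊥-elim (least r<m (_ , Sr))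

    basis : ∀ {a d b} → ℕ.NonZero a → L (+ a) 0ℤ → (∀ {k} → k < a → ¬ P k) →
            ℕ.NonZero d → L b (+ d) → (∀ {k} → k < d → ¬ Q k) → HermiteBasis L
    basis {a} {d} {b} a≢0 first a-least d≢0 second d-least = record
      { a = a ; d = d ; b = b ; a≢0 = a≢0 ; d≢0 = d≢0
      ; first = first ; second = second ; expand = expand }
      where
      instance
        _ = a≢0
        _ = d≢0

      remainder : ∀ z n .{{_ : ℕ.NonZero n}} → z - (z /ℕ n) * + n ≡ + (z %ℕ n)
      remainder z n = ≡.trans (cong (_- (z /ℕ n) * + n) (a≡a%ℕn+[a/ℕn]*n z n))
        (cancel (+ (z %ℕ n)) ((z /ℕ n) * + n))
        where
        cancel : ∀ x y → x + y - y ≡ x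
        cancel = solve-∀

      exact : ∀ z n .{{_ : ℕ.NonZero n}} → z %ℕ n ≡ 0 → z ≡ (z /ℕ n) * + n
      exact z n r≡0 = ≡.trans (a≡a%ℕn+[a/ℕn]*n z n)
        (≡.trans (cong (λ r → + r + (z /ℕ n) * + n) r≡0) (ℤ.+-identityˡ _))

      expand : ∀ {x y} → L x y → ∃₂ λ i j → x ≡ i * + a + j * b × y ≡ j * + d
      expand {x} {y} u = i , j , x≡ , y≡
        where
        -- The second coordinate is divided first: once it is cleared by a multiple of `second`, the
        -- vector lies on the first axis, where the minimality of `a` applies.
        j = y /ℕ d
        x′ = x - j * b

        u′ : L x′ (+ (y %ℕ d))
        u′ = subst (L x′) (remainder y d) (-‿closed u (scale j second))

        y%d≡0 : y %ℕ d ≡ 0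
        y%d≡0 = least⇒0 d-least (n%ℕd<d y d) (x′ , u′)

        y≡ : y ≡ j * + d
        y≡ = exact y d y%d≡0

        i = x′ /ℕ a

        u″ : L (+ (x′ %ℕ a)) 0ℤ
        u″ = subst₂ L (remainder x′ a) (cong (λ z → 0ℤ - z) (ℤ.*-zeroʳ i))
          (-‿closed (subst (λ r → L x′ (+ r)) y%d≡0 u′) (scale i first))

        x≡ : x ≡ i * + a + j * b
        x≡ = ≡.trans (shift x (j * b)) (cong (_+ j * b) (exact x′ a (least⇒0 a-least (n%ℕd<d x′ a) u″)))
          where
          shift : ∀ x y → x ≡ x - y + y
          shift = solve-∀

  module _ (B : HermiteBasis L) where

    open HermiteBasis B

    -- Euclidean division by `second` and then by `first` moves any point into the box of sides `a`
    -- and `d`. With `residues-distinct`, the box is a full set of coset representatives.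
    reduce : ∀ x y → ∃₂ λ (k : Fin a) (l : Fin d) → L (+ toℕ k - x) (+ toℕ l - y)
    reduce x y = fromℕ< (n%ℕd<d x′ a) , fromℕ< (n%ℕd<d y d) ,
      subst₂ L
        (≡.trans (difference x (x′ /ℕ a) (j * b) (+ a) (+ (x′ %ℕ a)) (a≡a%ℕn+[a/ℕn]*n x′ a))
                 (cong (λ n → + n - x) (≡.sym (toℕ-fromℕ< (n%ℕd<d x′ a)))))
        (≡.trans (difference₀ y j (+ d) (+ (y %ℕ d)) (a≡a%ℕn+[a/ℕn]*n y d))
                 (cong (λ n → + n - y) (≡.sym (toℕ-fromℕ< (n%ℕd<d y d)))))
        (neg (add (scale (x′ /ℕ a) first) (scale j second)))
      where
      j = y /ℕ d
      x′ = x - j * b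

      difference : ∀ x q z a r → x - z ≡ r + q * a → - (q * a + z) ≡ r - x
      difference x q z a r eq = ≡.trans (identity x q z a)
        (≡.trans (cong (λ w → w - q * a - x) eq) (identity′ x q a r))
        where
        identity : ∀ x q z a → - (q * a + z) ≡ x - z - q * a - x
        identity = solve-∀
        identity′ : ∀ x q a r → r + q * a - q * a - x ≡ r - x
        identity′ = solve-∀

      difference₀ : ∀ y q d r → y ≡ r + q * d → - (x′ /ℕ a * 0ℤ + q * d) ≡ r - y
      difference₀ _ q d r ≡.refl = identity (x′ /ℕ a) q d r
        where
        identity : ∀ k q d r → - (k * 0ℤ + q * d) ≡ r - (r + q * d)
        identity = solve-∀

    residues-distinct : ∀ {k k′ : Fin a} {l l′ : Fin d} →
      L (+ toℕ k - + toℕ k′) (+ toℕ l - + toℕ l′) → k ≡ k′ × l ≡ l′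
    residues-distinct {k} {k′} {l} {l′} u with expand u
    ... | i , j , x≡ , y≡ = toℕ-injective k≡k′ , toℕ-injective l≡l′
      where
      l≡l′ : toℕ l ≡ toℕ l′
      l≡l′ = diff<∧∣⇒≡ (toℕ<n l) (toℕ<n l′) (divides j y≡)

      j≡0 : j ≡ 0ℤ
      j≡0 = *-cancel-≢0 {+ d} {j} (λ d≡0 → ℕ.≢-nonZero⁻¹ d (ℤ.+-injective d≡0))
        (≡.trans (ℤ.*-comm (+ d) j) (≡.trans (≡.sym y≡) (ℤ.i≡j⇒i-j≡0 (cong +_ l≡l′))))

      k≡k′ : toℕ k ≡ toℕ k′
      k≡k′ = diff<∧∣⇒≡ (toℕ<n k) (toℕ<n k′)
        (divides i (≡.trans x≡ (≡.trans (cong (λ j → i * + a + j * b) j≡0) (ℤ.+-identityʳ _))))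

-- Quadratic rings

module IntegerScalars (R : CommutativeRing c ℓ) {ι : ℤ → CommutativeRing.Carrier R}
  (ι-isHomomorphism : IsRingHomomorphism ℤ.+-*-rawRing (CommutativeRing.rawRing R) ι) where

  open CommutativeRing R renaming (_+_ to _⊕_; _*_ to _⊗_; -_ to ⊖_; _-_ to _⊝_)
  open IsRingHomomorphism ι-isHomomorphism public using ()
    renaming (+-homo to ι-+; *-homo to ι-*; -‿homo to ι-neg; 0#-homo to ι-0; 1#-homo to ι-1)

  ι-sub : ∀ x y → ι (x - y) ≈ ι x ⊝ ι y
  ι-sub x y = trans (ι-+ x (- y)) (+-congˡ (ι-neg y))

  ι0*≈0 : ∀ x → ι 0ℤ ⊗ x ≈ 0#
  ι0*≈0 x = trans (*-congʳ ι-0) (zeroˡ x)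

  ι-morphism : ℤ.+-*-rawRing -Raw-AlmostCommutative⟶ fromCommutativeRing R
  ι-morphism = record
    { ⟦_⟧ = ι ; +-homo = ι-+ ; *-homo = ι-* ; -‿homo = ι-neg ; 0-homo = ι-0 ; 1-homo = ι-1 }

  -- The solver has to compare coefficients only, so they are compared in ℤ; equality in `R` may be
  -- undecidable.
  ι-≟ : ∀ x y → Maybe (ι x ≈ ι y)
  ι-≟ x y = map (reflexive ∘ cong ι) (dec⇒maybe (x ℤ.≟ y))

  open Solver ℤ.+-*-rawRing (fromCommutativeRing R) ι-morphism ι-≟ public
    using (solve; _:=_; _:+_; _:*_; _:-_; :-_)

-- The interface between the two halves of the proof: the norm inequality is derived from this
-- record, and every order is shown to have one in the double-negated sense.
record QuadraticBasis (R : CommutativeRing c ℓ) : Set (c ⊔ ℓ) where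
  open CommutativeRing R renaming (_+_ to _⊕_; _*_ to _⊗_)
  field
    ι                 : ℤ → Carrier
    ι-isHomomorphism  : IsRingHomomorphism ℤ.+-*-rawRing rawRing ι
    ω                 : Carrier
    span              : ∀ r → ∃₂ λ x y → r ≈ ι x ⊕ ι y ⊗ ω
    independent       : ∀ x y → ι x ⊕ ι y ⊗ ω ≈ 0# → x ≡ 0ℤ × y ≡ 0ℤ
    integral          : ∀ {x y} → x ⊗ y ≈ 0# → ¬ x ≈ 0# → y ≈ 0#

HasIndex-unique : {R : CommutativeRing c ℓ} {I : Ideal R ℓ₁} → ∀ {m n} → HasIndex I m → HasIndex I n → m ≡ n
HasIndex-unique f g = ↔⇒≡ (inverse (symmetric f) g)

module _ (S : Setoid c ℓ) where

  open Setoid S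

  -- That `to` respects the equivalence comes for free: equivalent elements have equivalent
  -- representatives, and these coincide because `from` is injective.
  section⇒inverse : ∀ {n} (from : Fin n → Carrier) (to : Carrier → Fin n) →
    (∀ x → from (to x) ≈ x) → (∀ {i j} → from i ≈ from j → i ≡ j) → Inverse S (≡.setoid (Fin n))
  section⇒inverse from to from-to from-injective = record
    { to        = to
    ; from      = from
    ; to-cong   = λ x≈y → from-injective (trans (from-to _) (trans x≈y (sym (from-to _))))
    ; from-cong = reflexive ∘ cong from
    ; inverse   = (λ x≈ → from-injective (trans (from-to _) x≈)) , (λ { ≡.refl → from-to _ })
    }

module Quadratic {R : CommutativeRing c ℓ} (B : QuadraticBasis R) where

  open CommutativeRing R renaming (_+_ to _⊕_; _*_ to _⊗_; -_ to ⊖_; _-_ to _⊝_)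
  open QuadraticBasis B
  open IntegerScalars R ι-isHomomorphism
  open Ideal using (member; ∈-resp-≈; 0∈; +-closed; *-absorb)

  elt : ℤ → ℤ → Carrier
  elt x y = ι x ⊕ ι y ⊗ ω

  elt-cong : ∀ {x y x′ y′} → x ≡ x′ → y ≡ y′ → elt x y ≈ elt x′ y′
  elt-cong ≡.refl ≡.refl = refl

  elt-sub : ∀ x y x′ y′ → elt (x - x′) (y - y′) ≈ elt x y ⊝ elt x′ y′
  elt-sub x y x′ y′ = trans (+-cong (ι-sub x x′) (*-congʳ (ι-sub y y′)))
    (solve 5 (λ a b a′ b′ w → (a :- a′) :+ (b :- b′) :* w := (a :+ b :* w) :- (a′ :+ b′ :* w))
      refl (ι x) (ι y) (ι x′) (ι y′) ω)

  elt-add : ∀ x y x′ y′ → elt (x + x′) (y + y′) ≈ elt x y ⊕ elt x′ y′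
  elt-add x y x′ y′ = trans (+-cong (ι-+ x x′) (*-congʳ (ι-+ y y′)))
    (solve 5 (λ a b a′ b′ w → (a :+ a′) :+ (b :+ b′) :* w := (a :+ b :* w) :+ (a′ :+ b′ :* w))
      refl (ι x) (ι y) (ι x′) (ι y′) ω)

  elt-neg : ∀ x y → elt (- x) (- y) ≈ ⊖ elt x y
  elt-neg x y = trans (+-cong (ι-neg x) (*-congʳ (ι-neg y)))
    (solve 3 (λ a b w → (:- a) :+ (:- b) :* w := :- (a :+ b :* w)) refl (ι x) (ι y) ω)

  elt-0 : elt 0ℤ 0ℤ ≈ 0#
  elt-0 = trans (+-cong ι-0 (ι0*≈0 ω)) (+-identityˡ 0#)

  elt-injective : ∀ {x y x′ y′} → elt x y ≈ elt x′ y′ → x ≡ x′ × y ≡ y′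
  elt-injective {x} {y} {x′} {y′} eq
    with independent (x - x′) (y - y′)
      (trans (elt-sub x y x′ y′) (trans (+-congʳ eq) (-‿inverseʳ (elt x′ y′))))
  ... | x-x′≡0 , y-y′≡0 = ℤ.i-j≡0⇒i≡j x x′ x-x′≡0 , ℤ.i-j≡0⇒i≡j y y′ y-y′≡0

  coord₀ coord₁ : Carrier → ℤ
  coord₀ r = proj₁ (span r)
  coord₁ r = proj₁ (proj₂ (span r))

  elt-coords : ∀ r → r ≈ elt (coord₀ r) (coord₁ r)
  elt-coords r = proj₂ (proj₂ (span r))

  coords-unique : ∀ {r x y} → r ≈ elt x y → coord₀ r ≡ x × coord₁ r ≡ y
  coords-unique r≈ = elt-injective (trans (sym (elt-coords _)) r≈)

  -- Coordinates reduce the question to two integers. This is what lets a negated inclusion in zero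
  -- yield a nonzero member in `nonzero-member`.
  _≈0? : ∀ r → Dec (r ≈ 0#)
  r ≈0? with coord₀ r ℤ.≟ 0ℤ | coord₁ r ℤ.≟ 0ℤ
  ... | yes x≡0 | yes y≡0 = yes (trans (elt-coords r) (trans (elt-cong x≡0 y≡0) elt-0))
  ... | no x≢0  | _       = no (λ r≈0 → x≢0 (proj₁ (coords-unique (trans r≈0 (sym elt-0)))))
  ... | yes _   | no y≢0  = no (λ r≈0 → y≢0 (proj₂ (coords-unique (trans r≈0 (sym elt-0)))))

  -- The coefficients of ω² = s + t ω: `t` is the trace of ω and `- s` its norm.
  s t : ℤ
  s = coord₀ (ω ⊗ ω)
  t = coord₁ (ω ⊗ ω)

  mul₀ mul₁ : ℤ → ℤ → ℤ → ℤ → ℤ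
  mul₀ x y u v = x * u + s * (y * v)
  mul₁ x y u v = x * v + y * u + t * (y * v)

  -- The solver does not know the relation for ω², so the expression is first brought into a form
  -- where `s + t ω` is an isolated factor; that factor is traded for ω² and the rest is a
  -- polynomial identity.
  elt-* : ∀ x y u v → elt (mul₀ x y u v) (mul₁ x y u v) ≈ elt x y ⊗ elt u v
  elt-* x y u v =
    trans (+-cong
        (trans (ι-+ _ _) (+-cong (ι-* x u) (trans (ι-* s _) (*-congˡ (ι-* y v)))))
        (*-congʳ (trans (ι-+ _ _) (+-cong (trans (ι-+ _ _) (+-cong (ι-* x v) (ι-* y u)))
                                          (trans (ι-* t _) (*-congˡ (ι-* y v)))))))
    (trans
      (solve 7 (λ s t x y u v w →
          (x :* u :+ s :* (y :* v)) :+ (x :* v :+ y :* u :+ t :* (y :* v)) :* w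
          := (x :* u :+ (x :* v :+ y :* u) :* w) :+ (y :* v) :* (s :+ t :* w))
        refl (ι s) (ι t) (ι x) (ι y) (ι u) (ι v) ω)
    (trans (+-congˡ (*-congˡ (sym (elt-coords (ω ⊗ ω)))))
      (solve 5 (λ x y u v w →
          (x :* u :+ (x :* v :+ y :* u) :* w) :+ (y :* v) :* (w :* w)
          := (x :+ y :* w) :* (u :+ v :* w))
        refl (ι x) (ι y) (ι u) (ι v) ω)))

  -- The coordinates of conj α * β, where conj ω = t - ω, are conj₀ and det.
  conj₀ : ℤ → ℤ → ℤ → ℤ → ℤ
  conj₀ x y x′ y′ = x * x′ + t * (y * x′) - s * (y * y′)

  -- Ideals as lattices of finite index

  module _ (I : Ideal R ℓ₁) where

    Lattice : ℤ → ℤ → Set ℓ₁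
    Lattice x y = member I (elt x y)

    isLattice : IsLattice Lattice
    isLattice = record
      { 0-mem    = ∈-resp-≈ I (sym elt-0) (0∈ I)
      ; -‿closed = λ {x} {y} {x′} {y′} u v → ∈-resp-≈ I
          (trans (+-congˡ (-1*x≈-x (elt x′ y′))) (sym (elt-sub x y x′ y′)))
          (+-closed I u (*-absorb I (⊖ 1#) v))
      }
      where open RingProperties ring using (-1*x≈-x)

    multiply : ∀ {x y} u v → Lattice x y → Lattice (mul₀ x y u v) (mul₁ x y u v)
    multiply {x} {y} u v m = ∈-resp-≈ I (trans (*-comm (elt u v) (elt x y)) (sym (elt-* x y u v)))
      (*-absorb I (elt u v) m)

    -- The lattice points of the `a` by `d` box represent the cosets, and `combine` with its inverse
    -- `remQuot` numbers them.
    hasIndex : (H : HermiteBasis Lattice) → HasIndex I (HermiteBasis.a H ℕ.* HermiteBasis.d H)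
    hasIndex H = section⇒inverse (Quotient I) from to from-to from-injective
      where
      open HermiteBasis H

      point : Fin a × Fin d → Carrier
      point (k , l) = elt (+ toℕ k) (+ toℕ l)

      residue : ∀ r → ∃[ kl ] member I (point kl ⊝ r)
      residue r =
        let k , l , m = reduce isLattice H (coord₀ r) (coord₁ r)
        in (k , l) , ∈-resp-≈ I
             (trans (elt-sub (+ toℕ k) (+ toℕ l) (coord₀ r) (coord₁ r))
               (+-congˡ (-‿cong (sym (elt-coords r))))) m

      from : Fin (a ℕ.* d) → Carrier
      from k = point (remQuot {a} d k)

      to : Carrier → Fin (a ℕ.* d)
      to r = uncurry combine (proj₁ (residue r))

      from-to : ∀ r → member I (from (to r) ⊝ r)
      from-to r = subst (λ kl → member I (point kl ⊝ r))
        (≡.sym (remQuot-combine (proj₁ (proj₁ (residue r))) (proj₂ (proj₁ (residue r)))))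
        (proj₂ (residue r))

      point-injective : ∀ kl kl′ → member I (point kl ⊝ point kl′) → kl ≡ kl′
      point-injective (k , l) (k′ , l′) m =
        let k≡k′ , l≡l′ = residues-distinct isLattice H
              (∈-resp-≈ I (sym (elt-sub (+ toℕ k) (+ toℕ l) (+ toℕ k′) (+ toℕ l′))) m)
        in cong₂ _,_ k≡k′ l≡l′

      from-injective : ∀ {k l} → member I (from k ⊝ from l) → k ≡ l
      from-injective {k} {l} m = ≡.trans (≡.sym (combine-remQuot {a} d k))
        (≡.trans (cong (uncurry combine) (point-injective _ _ m)) (combine-remQuot {a} d l))

    nonzero-member : NonZeroIdeal I → ¬ ¬ (∃[ r ] member I r × ¬ r ≈ 0#)
    nonzero-member I≢0 k = I≢0 λ {r} r∈I → decidable-stable (r ≈0?) (λ r≉0 → k (r , r∈I , r≉0))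

    -- The norm of α lies in α R, being the product of α and its conjugate.
    norm-member : NonZeroIdeal I → ¬ ¬ (∃[ N ] N ≢ 0ℤ × Lattice N 0ℤ × Lattice 0ℤ N)
    norm-member I≢0 k = nonzero-member I≢0 λ (r , r∈I , r≉0) →
      let x  = coord₀ r
          y  = coord₁ r
          -- The coordinates of the conjugate x + y (t - ω).
          u  = x + t * y
          v  = - y
          N  = mul₀ x y u v
          mul₁≡0 = vanish t x y
          Ne₁ : Lattice N 0ℤ
          Ne₁ = subst (Lattice N) mul₁≡0 (multiply u v (∈-resp-≈ I (elt-coords r) r∈I))
          Ne₂ : Lattice 0ℤ N
          Ne₂ = subst₂ Lattice (zero₀ s N) (unit₁ t N) (multiply 0ℤ 1ℤ Ne₁)
          N≢0 : N ≢ 0ℤ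
          -- With norm zero, the conjugate of the nonzero `r` would vanish, since there are no zero
          -- divisors; its coordinates then give back y = 0 and x = 0.
          N≢0 N≡0 =
            let r̄≈0 = integral (trans (*-congʳ (elt-coords r))
                        (trans (sym (elt-* x y u v)) (trans (elt-cong N≡0 mul₁≡0) elt-0))) r≉0
                u≡0 , v≡0 = independent u v r̄≈0
                y≡0 = ≡.trans (≡.sym (ℤ.neg-involutive y)) (cong -_ v≡0)
                x≡0 = ≡.trans (≡.sym (drop t x)) (≡.trans (cong (λ y → x + t * y) (≡.sym y≡0)) u≡0)
            in r≉0 (trans (elt-coords r) (trans (elt-cong x≡0 y≡0) elt-0))
      in k (N , N≢0 , Ne₁ , Ne₂)
      where
      vanish : ∀ t x y → x * (- y) + y * (x + t * y) + t * (y * (- y)) ≡ 0ℤ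
      vanish = solve-∀
      zero₀ : ∀ s N → N * 0ℤ + s * (0ℤ * 1ℤ) ≡ 0ℤ
      zero₀ = solve-∀
      unit₁ : ∀ t N → N * 1ℤ + 0ℤ * 0ℤ + t * (0ℤ * 1ℤ) ≡ N
      unit₁ = solve-∀
      drop : ∀ t x → x + t * 0ℤ ≡ x
      drop = solve-∀

    ideal-hermiteBasis : NonZeroIdeal I → ¬ ¬ HermiteBasis Lattice
    ideal-hermiteBasis I≢0 k = norm-member I≢0 λ (_ , N≢0 , Ne₁ , Ne₂) → hermiteBasis isLattice N≢0 Ne₁ Ne₂ k

    finiteIndex : NonZeroIdeal I → ¬ ¬ FiniteIndex I
    finiteIndex I≢0 k = ideal-hermiteBasis I≢0 λ H → k (_ , hasIndex H)

    module _ (H : HermiteBasis Lattice) where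

      open HermiteBasis H

      norm : ℤ
      norm = + a * + d

      -- norm divides det (α, ω β), which is conj₀ up to a multiple of det (α, β).
      ∣conj₀ : ∀ {x y x′ y′} → Lattice x y → Lattice x′ y′ → norm ∣ conj₀ x y x′ y′
      ∣conj₀ {x} {y} {x′} {y′} m m′ = subst (norm ∣_) (identity s t x y x′ y′)
        (∣m∣n⇒∣m-n (∣det m (multiply 0ℤ 1ℤ m′)) (∣n⇒∣m*n t (∣det m m′)))
        where
        identity : ∀ s t x y x′ y′ →
          (x * (x′ * 1ℤ + y′ * 0ℤ + t * (y′ * 1ℤ)) - y * (x′ * 0ℤ + s * (y′ * 1ℤ))) - t * (x * y′ - y * x′)
          ≡ x * x′ + t * (y * x′) - s * (y * y′)
        identity = solve-∀

  -- Determinants on a product of ideals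

  detᶜ : Carrier → Carrier → ℤ
  detᶜ r r′ = det (coord₀ r) (coord₁ r) (coord₀ r′) (coord₁ r′)

  detᶜ-cong : ∀ {r r′ x y x′ y′} → r ≈ elt x y → r′ ≈ elt x′ y′ → detᶜ r r′ ≡ det x y x′ y′
  detᶜ-cong r≈ r′≈ with coords-unique r≈ | coords-unique r′≈
  ... | x≡ , y≡ | x′≡ , y′≡ = cong₂ _-_ (cong₂ _*_ x≡ y′≡) (cong₂ _*_ y≡ x′≡)

  detᶜ-antisym : ∀ r r′ → detᶜ r r′ ≡ - detᶜ r′ r
  detᶜ-antisym r r′ = identity (coord₀ r) (coord₁ r) (coord₀ r′) (coord₁ r′)
    where
    identity : ∀ x y x′ y′ → x * y′ - y * x′ ≡ - (x′ * y - y′ * x)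
    identity = solve-∀

  module _ (k : ℤ) {S : Pred Carrier p} where

    -- For fixed `w` the determinant is additive in `z`, so the `z` with determinant divisible by
    -- `k` form a subgroup.
    ∣detᶜ-generatedʳ : ∀ {w z} → (∀ {z} → S z → k ∣ detᶜ w z) → Generated +-group S z → k ∣ detᶜ w z
    ∣detᶜ-generatedʳ         k∣ (gen z∈S) = k∣ z∈S
    ∣detᶜ-generatedʳ {w = w} k∣ unit = divides 0ℤ
      (≡.trans (detᶜ-cong (elt-coords w) (sym elt-0)) (identity (coord₀ w) (coord₁ w) k))
      where
      identity : ∀ x y k → x * 0ℤ - y * 0ℤ ≡ 0ℤ * k
      identity = solve-∀
    ∣detᶜ-generatedʳ {w = w} k∣ (mult {u} {v} u∈ v∈) = subst (k ∣_)
      (≡.sym (≡.trans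
        (detᶜ-cong (elt-coords w) (trans (+-cong (elt-coords u) (elt-coords v)) (sym (elt-add _ _ _ _))))
        (identity (coord₀ w) (coord₁ w) (coord₀ u) (coord₁ u) (coord₀ v) (coord₁ v))))
      (∣m∣n⇒∣m+n (∣detᶜ-generatedʳ k∣ u∈) (∣detᶜ-generatedʳ k∣ v∈))
      where
      identity : ∀ x y u₀ u₁ v₀ v₁ → x * (u₁ + v₁) - y * (u₀ + v₀) ≡ x * u₁ - y * u₀ + (x * v₁ - y * v₀)
      identity = solve-∀
    ∣detᶜ-generatedʳ {w = w} k∣ (inv {u} u∈) = subst (k ∣_)
      (≡.sym (≡.trans
        (detᶜ-cong (elt-coords w) (trans (-‿cong (elt-coords u)) (sym (elt-neg _ _))))
        (identity (coord₀ w) (coord₁ w) (coord₀ u) (coord₁ u))))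
      (∣m⇒∣-m (∣detᶜ-generatedʳ k∣ u∈))
      where
      identity : ∀ x y u₀ u₁ → x * (- u₁) - y * (- u₀) ≡ - (x * u₁ - y * u₀)
      identity = solve-∀
    ∣detᶜ-generatedʳ {w = w} k∣ (resp {u} u≈v u∈) = subst (k ∣_)
      (≡.sym (detᶜ-cong (elt-coords w) (trans (sym u≈v) (elt-coords u))))
      (∣detᶜ-generatedʳ k∣ u∈)

    -- The one-sided induction is run twice: for each generator in the second place, antisymmetry
    -- moves it to the first, and the induction then runs over `w`.
    ∣detᶜ-generated : ∀ {w z} → Generated +-group S w → Generated +-group S z →
      (∀ {w z} → S w → S z → k ∣ detᶜ w z) → k ∣ detᶜ w z
    ∣detᶜ-generated {w} {z} w∈ z∈ k∣ = ∣detᶜ-generatedʳ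
      (λ {z} z∈S → subst (k ∣_) (≡.sym (detᶜ-antisym w z)) (∣m⇒∣-m (∣detᶜ-generatedʳ (k∣ z∈S) w∈))) z∈

  module _ {I : Ideal R ℓ₁} {J : Ideal R ℓ₂} (HI : HermiteBasis (Lattice I)) (HJ : HermiteBasis (Lattice J)) where

    private
      module HI = HermiteBasis HI
      module HJ = HermiteBasis HJ

    ∣det-products : ∀ {α₀ α₁ β₀ β₁ y₀ y₁ z₀ z₁} →
      Lattice I α₀ α₁ → Lattice I β₀ β₁ → Lattice J y₀ y₁ → Lattice J z₀ z₁ →
      norm I HI * norm J HJ ∣
        det (mul₀ α₀ α₁ y₀ y₁) (mul₁ α₀ α₁ y₀ y₁) (mul₀ β₀ β₁ z₀ z₁) (mul₁ β₀ β₁ z₀ z₁)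
    ∣det-products {α₀} {α₁} {β₀} {β₁} {y₀} {y₁} {z₀} {z₁} α β y z =
      subst (norm I HI * norm J HJ ∣_) (≡.sym (identity s t α₀ α₁ β₀ β₁ y₀ y₁ z₀ z₁))
        (divides-form (∣conj₀ I HI α β) (HI.∣det α β) (∣conj₀ J HJ y z) (HJ.∣det y z))
      where
      divides-form : ∀ {l m u v p q} → l ∣ u → l ∣ v → m ∣ p → m ∣ q → l * m ∣ u * q + v * p + t * (v * q)
      divides-form {l} {m} (divides u ≡.refl) (divides v ≡.refl) (divides p ≡.refl) (divides q ≡.refl) =
        divides (u * q + v * p + t * (v * q)) (factor t l m u v p q)
        where
        factor : ∀ t l m u v p q →
          u * l * (q * m) + v * l * (p * m) + t * (v * l * (q * m)) ≡ (u * q + v * p + t * (v * q)) * (l * m)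
        factor = solve-∀

      -- The right-hand side is `mul₁` of the pairs (`conj₀`, `det`) for α, β and for y, z; each of
      -- its terms has one factor from either ideal.
      identity : ∀ s t α₀ α₁ β₀ β₁ y₀ y₁ z₀ z₁ →
        (α₀ * y₀ + s * (α₁ * y₁)) * (β₀ * z₁ + β₁ * z₀ + t * (β₁ * z₁))
          - (α₀ * y₁ + α₁ * y₀ + t * (α₁ * y₁)) * (β₀ * z₀ + s * (β₁ * z₁))
        ≡ (α₀ * β₀ + t * (α₁ * β₀) - s * (α₁ * β₁)) * (y₀ * z₁ - y₁ * z₀)
          + (α₀ * β₁ - α₁ * β₀) * (y₀ * z₀ + t * (y₁ * z₀) - s * (y₁ * z₁))
          + t * ((α₀ * β₁ - α₁ * β₀) * (y₀ * z₁ - y₁ * z₀))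
      identity = solve-∀

    ∣detᶜ-product : ∀ {w z} → member (I · J) w → member (I · J) z → norm I HI * norm J HJ ∣ detᶜ w z
    ∣detᶜ-product w∈ z∈ = ∣detᶜ-generated (norm I HI * norm J HJ) w∈ z∈
      λ (α , y , α∈ , y∈ , w≈) (β , z , β∈ , z∈ , z≈) → subst (norm I HI * norm J HJ ∣_)
        (≡.sym (detᶜ-cong (product-coords w≈) (product-coords z≈)))
        (∣det-products (coords∈ I α∈) (coords∈ I β∈) (coords∈ J y∈) (coords∈ J z∈))
      where
      product-coords : ∀ {r α y} → r ≈ α ⊗ y →
        r ≈ elt (mul₀ (coord₀ α) (coord₁ α) (coord₀ y) (coord₁ y))
                (mul₁ (coord₀ α) (coord₁ α) (coord₀ y) (coord₁ y))
      product-coords r≈ = trans r≈ (trans (*-cong (elt-coords _) (elt-coords _)) (sym (elt-* _ _ _ _)))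

      coords∈ : ∀ {ℓ} (I : Ideal R ℓ) {r} → member I r → Lattice I (coord₀ r) (coord₁ r)
      coords∈ I = ∈-resp-≈ I (elt-coords _)

    index-bound : (H : HermiteBasis (Lattice (I · J))) →
      (HI.a ℕ.* HI.d) ℕ.* (HJ.a ℕ.* HJ.d) ℕ.≤ HermiteBasis.a H ℕ.* HermiteBasis.d H
    -- Divisibility gives an inequality because the right-hand index `a * d` is nonzero.
    index-bound H = ℕ∣.∣⇒≤ {{ℕ.m*n≢0 a d}} (subst₂ ℕ∣._∣_ norms (ℤ.abs-* (+ a) (+ d))
      (∣⇒∣ᵤ (subst (norm I HI * norm J HJ ∣_) volume (∣detᶜ-product first second))))
      where
      open HermiteBasis H
      norms : ∣ norm I HI * norm J HJ ∣ ≡ (HI.a ℕ.* HI.d) ℕ.* (HJ.a ℕ.* HJ.d)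
      norms = ≡.trans (ℤ.abs-* (norm I HI) (norm J HJ))
        (cong₂ ℕ._*_ (ℤ.abs-* (+ HI.a) (+ HI.d)) (ℤ.abs-* (+ HJ.a) (+ HJ.d)))
      volume : detᶜ (elt (+ a) 0ℤ) (elt b (+ d)) ≡ + a * + d
      volume = ≡.trans (detᶜ-cong refl refl) (identity (+ a) (+ d) b)
        where
        identity : ∀ a d b → a * d - 0ℤ * b ≡ a * d
        identity = solve-∀

  module _ (I : Ideal R ℓ₁) (J : Ideal R ℓ₂) where

    ·-nonZero : NonZeroIdeal I → NonZeroIdeal J → NonZeroIdeal (I · J)
    ·-nonZero I≢0 J≢0 IJ≈0 = nonzero-member I I≢0 λ (x , x∈ , x≉0) → nonzero-member J J≢0 λ (y , y∈ , y≉0) →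
      y≉0 (integral (IJ≈0 (gen (x , y , x∈ , y∈ , refl))) x≉0)

    normInequality : NonZeroIdeal I → NonZeroIdeal J → NormInequality I J
    normInequality I≢0 J≢0 = record
      { finiteˡ = finiteIndex I I≢0
      ; finiteʳ = finiteIndex J J≢0
      ; finite· = finiteIndex (I · J) IJ≢0
      ; bound   = λ {l} {m} {n} l-index m-index n-index → decidable-stable (l ℕ.* m ℕ.≤? n) λ k →
          ideal-hermiteBasis I I≢0 λ HI →
          ideal-hermiteBasis J J≢0 λ HJ →
          ideal-hermiteBasis (I · J) IJ≢0 λ H →
          k (subst₂ ℕ._≤_
            (cong₂ ℕ._*_ (HasIndex-unique {I = I} (hasIndex I HI) l-index)
                         (HasIndex-unique {I = J} (hasIndex J HJ) m-index))
            (HasIndex-unique {I = I · J} (hasIndex (I · J) H) n-index)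
            (index-bound {I = I} {J = J} HI HJ H))
      }
      where
      IJ≢0 : NonZeroIdeal (I · J)
      IJ≢0 = ·-nonZero I≢0 J≢0

    -- If all products vanished, `I · J` would be zero and its quotient would be `R`, which contains
    -- the integers. Among the `n + 1` integers from 0 to `n` two would be congruent, hence equal.
    finiteIndex⇒¬zero : FiniteIndex (I · J) → ¬ (∀ {x y} → member I x → member J y → x ⊗ y ≈ 0#)
    finiteIndex⇒¬zero (n , index) xy≈0
      with pigeonhole (ℕ.n<1+n n) (λ k → Inverse.to index (elt (+ toℕ k) 0ℤ))
    ... | k , l , k<l , eq = Fin.<⇒≢ k<l (toℕ-injective (ℤ.+-injective
      (proj₁ (elt-injective (trans (sym (+-identityʳ _)) (trans (+-congˡ (sym (-‿inverseˡ _)))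
        (trans (sym (+-assoc _ _ _)) (trans (+-congʳ (zero-product congruent)) (+-identityˡ _)))))))))
      where
      congruent : member (I · J) (elt (+ toℕ k) 0ℤ ⊝ elt (+ toℕ l) 0ℤ)
      congruent = Setoid.trans (Quotient (I · J))
        (Setoid.sym (Quotient (I · J)) (Inverse.strictlyInverseʳ index _))
        (Inverse.inverseʳ index eq)

      zero-product : ∀ {z} → member (I · J) z → z ≈ 0#
      zero-product (gen (x , y , x∈ , y∈ , z≈)) = trans z≈ (xy≈0 x∈ y∈)
      zero-product unit = refl
      zero-product (mult u v) = trans (+-cong (zero-product u) (zero-product v)) (+-identityˡ 0#)
      zero-product (inv u) = trans (-‿cong (zero-product u)) -0#≈0#
        where open RingProperties ring using (-0#≈0#)
      zero-product (resp u≈v u) = trans (sym u≈v) (zero-product u)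

    finiteIndex⇒nonZero : FiniteIndex (I · J) → NonZeroIdeal I × NonZeroIdeal J
    finiteIndex⇒nonZero fin =
      (λ I≈0 → finiteIndex⇒¬zero fin (λ x∈ _ → trans (*-congʳ (I≈0 x∈)) (zeroˡ _))) ,
      (λ J≈0 → finiteIndex⇒¬zero fin (λ _ y∈ → trans (*-congˡ (J≈0 y∈)) (zeroʳ _)))

-- Orders in quadratic fields

-- Sealed, so that unification can recover an integer from its image.
abstract

  integer : ℤ → ℚ
  integer z = ℚ.fromℚᵘ (mkℚᵘ z 0)

  toℚᵘ-integer : ∀ z → ℚ.toℚᵘ (integer z) ℚᵘ.≃ mkℚᵘ z 0
  toℚᵘ-integer z = ℚ.toℚᵘ-fromℚᵘ (mkℚᵘ z 0)

  integer-+ : ∀ x y → integer (x + y) ≡ integer x ℚ.+ integer y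
  integer-+ x y = ℚ.toℚᵘ-injective (begin
    ℚ.toℚᵘ (integer (x + y))                      ≈⟨ toℚᵘ-integer (x + y) ⟩
    mkℚᵘ (x + y) 0                                ≈⟨ *≡* (identity x y) ⟩
    mkℚᵘ x 0 ℚᵘ.+ mkℚᵘ y 0                        ≈⟨ ℚᵘ.+-cong (toℚᵘ-integer x) (toℚᵘ-integer y) ⟨
    ℚ.toℚᵘ (integer x) ℚᵘ.+ ℚ.toℚᵘ (integer y)    ≈⟨ ℚ.toℚᵘ-homo-+ (integer x) (integer y) ⟨
    ℚ.toℚᵘ (integer x ℚ.+ integer y)              ∎)
    where
    open SetoidReasoning ℚᵘ.≃-setoid
    identity : ∀ x y → (x + y) * 1ℤ ≡ (x * 1ℤ + y * 1ℤ) * 1ℤ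
    identity = solve-∀

  integer-* : ∀ x y → integer (x * y) ≡ integer x ℚ.* integer y
  integer-* x y = ℚ.toℚᵘ-injective (begin
    ℚ.toℚᵘ (integer (x * y))                      ≈⟨ toℚᵘ-integer (x * y) ⟩
    mkℚᵘ x 0 ℚᵘ.* mkℚᵘ y 0                        ≈⟨ ℚᵘ.*-cong (toℚᵘ-integer x) (toℚᵘ-integer y) ⟨
    ℚ.toℚᵘ (integer x) ℚᵘ.* ℚ.toℚᵘ (integer y)    ≈⟨ ℚ.toℚᵘ-homo-* (integer x) (integer y) ⟨
    ℚ.toℚᵘ (integer x ℚ.* integer y)              ∎)
    where open SetoidReasoning ℚᵘ.≃-setoid

  integer-neg : ∀ x → integer (- x) ≡ ℚ.- integer x
  integer-neg x = ℚ.toℚᵘ-injective (begin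
    ℚ.toℚᵘ (integer (- x))    ≈⟨ toℚᵘ-integer (- x) ⟩
    ℚᵘ.- mkℚᵘ x 0             ≈⟨ ℚᵘ.-‿cong (toℚᵘ-integer x) ⟨
    ℚᵘ.- ℚ.toℚᵘ (integer x)   ≈⟨ ℚ.toℚᵘ-homo‿- (integer x) ⟨
    ℚ.toℚᵘ (ℚ.- integer x)    ∎)
    where open SetoidReasoning ℚᵘ.≃-setoid

  integer-injective : ∀ {x} → integer x ≡ 0ℚ → x ≡ 0ℤ
  integer-injective {x} eq with ℚ.fromℚᵘ-injective {mkℚᵘ x 0} {mkℚᵘ 0ℤ 0} eq
  ... | *≡* x*1≡0 = ≡.trans (≡.sym (ℤ.*-identityʳ x)) x*1≡0

  clear-denominator : ∀ q → q ℚ.* integer (ℚ.↧ q) ≡ integer (ℚ.↥ q)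
  clear-denominator q = ℚ.toℚᵘ-injective (begin
    ℚ.toℚᵘ (q ℚ.* integer (ℚ.↧ q))                 ≈⟨ ℚ.toℚᵘ-homo-* q (integer (ℚ.↧ q)) ⟩
    ℚ.toℚᵘ q ℚᵘ.* ℚ.toℚᵘ (integer (ℚ.↧ q))         ≈⟨ ℚᵘ.*-congˡ {ℚ.toℚᵘ q} (toℚᵘ-integer (ℚ.↧ q)) ⟩
    ℚ.toℚᵘ q ℚᵘ.* mkℚᵘ (ℚ.↧ q) 0                   ≈⟨ cleared q ⟩
    mkℚᵘ (ℚ.↥ q) 0                                 ≈⟨ toℚᵘ-integer (ℚ.↥ q) ⟨
    ℚ.toℚᵘ (integer (ℚ.↥ q))                       ∎)
    where
    open SetoidReasoning ℚᵘ.≃-setoid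
    cleared : ∀ q → ℚ.toℚᵘ q ℚᵘ.* mkℚᵘ (ℚ.↧ q) 0 ℚᵘ.≃ mkℚᵘ (ℚ.↥ q) 0
    cleared (ℚ.mkℚ n d-1 _) = *≡* (≡.trans (ℤ.*-identityʳ (n * + suc d-1))
      (cong (λ d → n * + d) (≡.sym (ℕ.*-identityʳ (suc d-1)))))

  integer-isHomomorphism : IsRingHomomorphism ℤ.+-*-rawRing ℚ.+-*-rawRing integer
  integer-isHomomorphism = record
    { isSemiringHomomorphism = record
      { isNearSemiringHomomorphism = record
        { +-isMonoidHomomorphism = record
          { isMagmaHomomorphism = record
            { isRelHomomorphism = record { cong = cong integer }
            ; homo              = integer-+
            }
          ; ε-homo = ≡.refl
          }
        ; *-homo = integer-*
        }
      ; 1#-homo = ≡.refl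
      }
    ; -‿homo = integer-neg
    }

-- Rational bases of a quadratic field

module QuadraticFieldProperties (K : QuadraticField c ℓ ℓ′) where

  private module K = NumberField K

  open CommutativeRing K.commutativeRing hiding (zero)
    renaming (_+_ to _⊕_; _*_ to _⊗_; -_ to ⊖_; _-_ to _⊝_)

  ι : ℤ → Carrier
  ι = K.fromℚ ∘ integer

  ι-isHomomorphism : IsRingHomomorphism ℤ.+-*-rawRing rawRing ι
  ι-isHomomorphism = isRingHomomorphism trans integer-isHomomorphism K.fromℚ-isHomomorphism

  open IntegerScalars K.commutativeRing ι-isHomomorphism public

  #0⇒unit : ∀ {x} → x K.# 0# → ∃[ x⁻¹ ] x ⊗ x⁻¹ ≈ 1#
  #0⇒unit {x} x#0 with K.#⇒invertible x#0
  ... | x⁻¹ , _ , eq = x⁻¹ , trans (*-congʳ (sym (trans (+-congˡ -0#≈0#) (+-identityʳ x)))) eq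
    where open RingProperties ring using (-0#≈0#)

  unit-cancel : ∀ {x x⁻¹ y} → x ⊗ x⁻¹ ≈ 1# → x ⊗ y ≈ 0# → y ≈ 0#
  unit-cancel {x} {x⁻¹} {y} xx⁻¹≈1 xy≈0 =
    trans (sym (*-identityˡ y)) (trans (*-congʳ (trans (sym xx⁻¹≈1) (*-comm x x⁻¹)))
      (trans (*-assoc x⁻¹ x y) (trans (*-congˡ xy≈0) (zeroʳ x⁻¹))))

  -- Tightness reduces the claim to refuting that `y` is apart from zero: such a `y` would be
  -- invertible and force `x` to be zero.
  field-integral : ∀ {x y} → x ⊗ y ≈ 0# → ¬ x ≈ 0# → y ≈ 0#
  field-integral {x} {y} xy≈0 x≉0 = proj₁ (K.tight y 0#) λ y#0 →
    x≉0 (unit-cancel (proj₂ (#0⇒unit y#0)) (trans (*-comm y x) xy≈0))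

  -- A basis over ℚ expressed with integers only: the denominators of the coefficients are collected
  -- in `D`.
  record RationalBasis (u v : Carrier) : Set (c ⊔ ℓ) where
    field
      independent : ∀ A B → ι A ⊗ u ⊕ ι B ⊗ v ≈ 0# → A ≡ 0ℤ × B ≡ 0ℤ
      spanning    : ∀ z → ∃[ D ] D ≢ 0ℤ × ∃₂ λ A B → ι D ⊗ z ≈ ι A ⊗ u ⊕ ι B ⊗ v

  rationalBasis : RationalBasis (K.basis zero) (K.basis (suc zero))
  rationalBasis = record { independent = independent ; spanning = spanning }
    where
    b₀ = K.basis zero
    b₁ = K.basis (suc zero)

    independent : ∀ A B → ι A ⊗ b₀ ⊕ ι B ⊗ b₁ ≈ 0# → A ≡ 0ℤ × B ≡ 0ℤ
    independent A B eq = integer-injective (vanishes zero) , integer-injective (vanishes (suc zero))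
      where
      q : Fin 2 → ℚ
      q zero    = integer A
      q (suc _) = integer B
      vanishes : ∀ k → q k ≡ 0ℚ
      vanishes = K.independent q (trans (+-congˡ (+-identityʳ _)) eq)

    cleared : ∀ q → K.fromℚ q ⊗ ι (ℚ.↧ q) ≈ ι (ℚ.↥ q)
    cleared q = trans (sym (IsRingHomomorphism.*-homo K.fromℚ-isHomomorphism q (integer (ℚ.↧ q))))
      (reflexive (cong K.fromℚ (clear-denominator q)))

    spanning : ∀ z → ∃[ D ] D ≢ 0ℤ × ∃₂ λ A B → ι D ⊗ z ≈ ι A ⊗ b₀ ⊕ ι B ⊗ b₁
    spanning z with K.spanning z
    ... | q , z≈ = d₀ * d₁ , *-≢0 {d₀} {d₁} (λ ()) (λ ()) , n₀ * d₁ , n₁ * d₀ ,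
      trans (*-cong (ι-* d₀ d₁) (trans z≈ (+-congˡ (+-identityʳ _))))
      (trans (solve 6 (λ f₀ f₁ d₀ d₁ b₀ b₁ →
               d₀ :* d₁ :* (f₀ :* b₀ :+ f₁ :* b₁) := f₀ :* d₀ :* d₁ :* b₀ :+ f₁ :* d₁ :* d₀ :* b₁)
               refl (K.fromℚ (q zero)) (K.fromℚ (q (suc zero))) (ι d₀) (ι d₁) b₀ b₁)
        (+-cong (*-congʳ (trans (*-congʳ (cleared (q zero))) (sym (ι-* n₀ d₁))))
                (*-congʳ (trans (*-congʳ (cleared (q (suc zero)))) (sym (ι-* n₁ d₀))))))
      where
      d₀ = ℚ.↧ (q zero)
      d₁ = ℚ.↧ (q (suc zero))
      n₀ = ℚ.↥ (q zero)
      n₁ = ℚ.↥ (q (suc zero))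

  -- Characteristic zero is read off from the independence of the basis: a vanishing `ι D` would
  -- annihilate the first basis vector.
  ι-≉0 : ∀ {D} → D ≢ 0ℤ → ¬ ι D ≈ 0#
  ι-≉0 {D} D≢0 ιD≈0 = D≢0 (proj₁ (RationalBasis.independent rationalBasis D 0ℤ
    (trans (+-cong (trans (*-congʳ ιD≈0) (zeroˡ _)) (ι0*≈0 _)) (+-identityˡ 0#))))

  ι-cancel : ∀ {D x y} → D ≢ 0ℤ → ι D ⊗ x ≈ ι D ⊗ y → x ≈ y
  ι-cancel {D} {x} {y} D≢0 eq = trans (solve 2 (λ x y → x := x :- y :+ y) refl x y)
    (trans (+-congʳ (field-integral
      (trans (solve 3 (λ d x y → d :* (x :- y) := d :* x :- d :* y) refl (ι D) x y)
        (trans (+-congʳ eq) (-‿inverseʳ (ι D ⊗ y))))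
      (ι-≉0 D≢0))) (+-identityˡ y))

  module _ {u v : Carrier} (B : RationalBasis u v) where

    open RationalBasis B

    swap : RationalBasis v u
    swap = record
      { independent = λ A B eq → let B≡0 , A≡0 = independent B A (trans (+-comm _ _) eq) in A≡0 , B≡0
      ; spanning    = λ z → let D , D≢0 , A , B , eq = spanning z in D , D≢0 , B , A , trans eq (+-comm _ _)
      }

    rescale : ∀ {w w⁻¹} → w ⊗ w⁻¹ ≈ 1# → RationalBasis (w ⊗ u) (w ⊗ v)
    rescale {w} {w⁻¹} ww⁻¹≈1 = record
      { independent = λ A B eq → independent A B (unit-cancel ww⁻¹≈1
          (trans (solve 5 (λ w a b u v → w :* (a :* u :+ b :* v) := a :* (w :* u) :+ b :* (w :* v))
                   refl w (ι A) (ι B) u v) eq))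
      ; spanning = λ z → let D , D≢0 , A , B , eq = spanning (w⁻¹ ⊗ z) in D , D≢0 , A , B ,
          trans (*-congˡ (trans (sym (*-identityˡ z)) (*-congʳ (sym ww⁻¹≈1))))
          (trans (solve 4 (λ d w w⁻¹ z → d :* (w :* w⁻¹ :* z) := w :* (d :* (w⁻¹ :* z))) refl (ι D) w w⁻¹ z)
          (trans (*-congˡ eq)
            (solve 5 (λ w a b u v → w :* (a :* u :+ b :* v) := a :* (w :* u) :+ b :* (w :* v))
              refl w (ι A) (ι B) u v)))
      }

    -- Steinitz exchange with denominators. A relation between `w` and `v` is multiplied by `E` to
    -- become one between `u` and `v`; conversely, an expansion in `u` and `v` is multiplied by `P`,
    -- and P u is replaced by E w - Q v.
    exchange : ∀ {w E P Q} → E ≢ 0ℤ → P ≢ 0ℤ → ι E ⊗ w ≈ ι P ⊗ u ⊕ ι Q ⊗ v → RationalBasis w v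
    exchange {w} {E} {P} {Q} E≢0 P≢0 w≈ = record { independent = independent′ ; spanning = spanning′ }
      where
      independent′ : ∀ X Y → ι X ⊗ w ⊕ ι Y ⊗ v ≈ 0# → X ≡ 0ℤ × Y ≡ 0ℤ
      independent′ X Y eq = X≡0 , *-cancel-≢0 E≢0 EY≡0
        where
        relation : ι (X * P) ⊗ u ⊕ ι (X * Q + E * Y) ⊗ v ≈ 0#
        relation =
          trans (+-cong (*-congʳ (ι-* X P)) (*-congʳ (trans (ι-+ _ _) (+-cong (ι-* X Q) (ι-* E Y)))))
          (trans (solve 7 (λ x p q e y u v →
                     x :* p :* u :+ (x :* q :+ e :* y) :* v := x :* (p :* u :+ q :* v) :+ e :* y :* v)
                   refl (ι X) (ι P) (ι Q) (ι E) (ι Y) u v)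
          (trans (+-congʳ (*-congˡ (sym w≈)))
          (trans (solve 5 (λ x e w y v → x :* (e :* w) :+ e :* y :* v := e :* (x :* w :+ y :* v))
                   refl (ι X) (ι E) w (ι Y) v)
          (trans (*-congˡ eq) (zeroʳ _)))))
        X≡0 : X ≡ 0ℤ
        X≡0 = *-cancel-≢0 P≢0 (≡.trans (ℤ.*-comm P X) (proj₁ (independent _ _ relation)))
        EY≡0 : E * Y ≡ 0ℤ
        EY≡0 = ≡.trans (≡.sym (ℤ.+-identityˡ (E * Y)))
          (≡.trans (cong (λ X → X * Q + E * Y) (≡.sym X≡0)) (proj₂ (independent _ _ relation)))

      spanning′ : ∀ z → ∃[ D ] D ≢ 0ℤ × ∃₂ λ A B → ι D ⊗ z ≈ ι A ⊗ w ⊕ ι B ⊗ v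
      spanning′ z with spanning z
      ... | D , D≢0 , A , B , eq = P * D , *-≢0 P≢0 D≢0 , A * E , P * B - A * Q ,
        trans (*-congʳ (ι-* P D))
        (trans (*-assoc _ _ _)
        (trans (*-congˡ eq)
        (trans (solve 6 (λ p a b q u v →
                   p :* (a :* u :+ b :* v) := a :* (p :* u :+ q :* v) :+ (p :* b :- a :* q) :* v)
                 refl (ι P) (ι A) (ι B) (ι Q) u v)
          (+-cong (trans (*-congˡ (sym w≈)) (trans (sym (*-assoc _ _ _)) (*-congʳ (sym (ι-* A E)))))
                  (*-congʳ (sym (trans (ι-sub _ _) (+-cong (ι-* P B) (-‿cong (ι-* A Q))))))))))

    enlarge : ∀ F {D A B z} →
      ι D ⊗ z ≈ ι A ⊗ u ⊕ ι B ⊗ v → ι F ⊗ ι D ⊗ z ≈ ι (F * A) ⊗ u ⊕ ι (F * B) ⊗ v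
    enlarge F {D} {A} {B} {z} eq = trans (*-assoc _ _ _) (trans (*-congˡ eq)
      (trans (solve 5 (λ f a b u v → f :* (a :* u :+ b :* v) := f :* a :* u :+ f :* b :* v)
                 refl (ι F) (ι A) (ι B) u v)
        (+-cong (*-congʳ (sym (ι-* F A))) (*-congʳ (sym (ι-* F B))))))

    common-denominator : ∀ {n} (g : Fin n → Carrier) →
      ∃[ D ] D ≢ 0ℤ × (∀ k → ∃₂ λ A B → ι D ⊗ g k ≈ ι A ⊗ u ⊕ ι B ⊗ v)
    common-denominator {zero}  g = 1ℤ , (λ ()) , λ ()
    common-denominator {suc n} g with spanning (g zero) | common-denominator (g ∘ suc)
    ... | E , E≢0 , A , B , eq | D , D≢0 , eqs = E * D , *-≢0 E≢0 D≢0 , λ where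
      zero    → D * A , D * B ,
        trans (*-congʳ (trans (reflexive (cong ι (ℤ.*-comm E D))) (ι-* D E))) (enlarge D eq)
      (suc k) → let A , B , eq = eqs k in E * A , E * B , trans (*-congʳ (ι-* E D)) (enlarge E eq)

  -- Some coefficient in the expansion of a nonzero multiple of 1 is nonzero, and 1 can be exchanged
  -- for that basis vector. Having 1 in the basis is what makes the first vector of the Hermite
  -- basis rational.
  one-extends : ∀ {u v} → RationalBasis u v → RationalBasis 1# u ⊎ RationalBasis 1# v
  one-extends basis with RationalBasis.spanning basis 1#
  ... | D , D≢0 , A , B , eq with A ℤ.≟ 0ℤ | B ℤ.≟ 0ℤ
  ...   | no A≢0  | _        = inj₂ (exchange basis D≢0 A≢0 eq)
  ...   | yes _   | no B≢0   = inj₁ (exchange (swap basis) D≢0 B≢0 (trans eq (+-comm _ _)))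
  ...   | yes A≡0 | yes B≡0  = ⊥-elim (ι-≉0 D≢0
    (trans (sym (*-identityʳ (ι D))) (trans eq (trans (+-cong (vanish A≡0) (vanish B≡0)) (+-identityˡ 0#)))))
    where
    vanish : ∀ {X x} → X ≡ 0ℤ → ι X ⊗ x ≈ 0#
    vanish ≡.refl = ι0*≈0 _

-- Integral bases of an order

module OrderProperties (K : QuadraticField c ℓ ℓ′) (R : Order K p) where

  private module K = NumberField K

  open CommutativeRing K.commutativeRing hiding (zero)
    renaming (_+_ to _⊕_; _*_ to _⊗_; -_ to ⊖_; _-_ to _⊝_)
  open QuadraticFieldProperties K
  open Order R using
    (member; ∈-resp-≈; 0∈; 1∈; +-closed; *-closed; -‿closed; orderRing; finitelyGenerated; fractions)

  ι∈ : ∀ z → member (ι z)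
  ι∈ (+ n)    = ι∈ℕ n
    where
    ι∈ℕ : ∀ n → member (ι (+ n))
    ι∈ℕ zero    = ∈-resp-≈ (sym ι-0) 0∈
    ι∈ℕ (suc n) = ∈-resp-≈ (sym (ι-+ 1ℤ (+ n))) (+-closed (∈-resp-≈ (sym ι-1) 1∈) (ι∈ℕ n))
  ι∈ -[1+ n ] = ∈-resp-≈ (sym (ι-neg (+ suc n))) (-‿closed (ι∈ (+ suc n)))

  ι-ring-isHomomorphism :
    IsRingHomomorphism ℤ.+-*-rawRing (CommutativeRing.rawRing orderRing) (λ z → ι z , ι∈ z)
  ι-ring-isHomomorphism = record
    { isSemiringHomomorphism = record
      { isNearSemiringHomomorphism = record
        { +-isMonoidHomomorphism = record
          { isMagmaHomomorphism = record
            { isRelHomomorphism = record { cong = reflexive ∘ cong ι }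
            ; homo              = ι-+
            }
          ; ε-homo = ι-0
          }
        ; *-homo = ι-*
        }
      ; 1#-homo = ι-1
      }
    ; -‿homo = ι-neg
    }

  -- Writing the basis of K as x₀/y₀, x₁/y₁ and multiplying by y₀ y₁ moves it into R.
  rationalBasis∈ : ∃₂ λ u v → member u × member v × RationalBasis u v
  rationalBasis∈ =
    let x₀ , y₀ , x₀∈ , y₀∈ , y₀#0 , eq₀ = fractions b₀
        x₁ , y₁ , x₁∈ , y₁∈ , y₁#0 , eq₁ = fractions b₁
        y₀⁻¹ , y₀y₀⁻¹≈1 = #0⇒unit y₀#0
        y₁⁻¹ , y₁y₁⁻¹≈1 = #0⇒unit y₁#0
    in y₀ ⊗ y₁ ⊗ b₀ , y₀ ⊗ y₁ ⊗ b₁ ,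
      ∈-resp-≈ (trans (*-congʳ (sym eq₀)) (rearrange₀ b₀ y₀ y₁)) (*-closed x₀∈ y₁∈) ,
      ∈-resp-≈ (trans (*-congʳ (sym eq₁)) (rearrange₁ b₁ y₀ y₁)) (*-closed x₁∈ y₀∈) ,
      rescale rationalBasis {w⁻¹ = y₀⁻¹ ⊗ y₁⁻¹}
        (trans (interchange y₀ y₁ y₀⁻¹ y₁⁻¹) (trans (*-cong y₀y₀⁻¹≈1 y₁y₁⁻¹≈1) (*-identityˡ 1#)))
    where
    b₀ = K.basis zero
    b₁ = K.basis (suc zero)

    rearrange₀ : ∀ b y z → b ⊗ y ⊗ z ≈ y ⊗ z ⊗ b
    rearrange₀ = solve 3 (λ b y z → b :* y :* z := y :* z :* b) refl
    rearrange₁ : ∀ b y z → b ⊗ z ⊗ y ≈ y ⊗ z ⊗ b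
    rearrange₁ = solve 3 (λ b y z → b :* z :* y := y :* z :* b) refl
    interchange : ∀ y z y′ z′ → y ⊗ z ⊗ (y′ ⊗ z′) ≈ y ⊗ y′ ⊗ (z ⊗ z′)
    interchange = solve 4 (λ y z y′ z′ → y :* z :* (y′ :* z′) := y :* y′ :* (z :* z′)) refl

  rationalBasis-one : ∃[ r ] member r × RationalBasis 1# r
  rationalBasis-one = let u , v , u∈ , v∈ , basis = rationalBasis∈ in select u∈ v∈ (one-extends basis)
    where
    select : ∀ {u v} → member u → member v → RationalBasis 1# u ⊎ RationalBasis 1# v →
      ∃[ r ] member r × RationalBasis 1# r
    select u∈ v∈ (inj₁ basis) = _ , u∈ , basis
    select u∈ v∈ (inj₂ basis) = _ , v∈ , basis

  record IntegralBasis (e₀ e₁ : Carrier) : Set (c ⊔ ℓ ⊔ p) where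
    field
      e₀∈         : member e₀
      e₁∈         : member e₁
      independent : ∀ i j → ι i ⊗ e₀ ⊕ ι j ⊗ e₁ ≈ 0# → i ≡ 0ℤ × j ≡ 0ℤ
      spanning    : ∀ {x} → member x → ∃₂ λ i j → x ≈ ι i ⊗ e₀ ⊕ ι j ⊗ e₁

  -- R is a lattice between ℤ + ℤ r and its multiple by 1/D; e₀ is taken rational.
  module _ {r} (r∈ : member r) (basis : RationalBasis 1# r) {D} (D≢0 : D ≢ 0ℤ) where

    open RationalBasis basis

    _∼_,_ : Carrier → ℤ → ℤ → Set ℓ
    x ∼ A , B = ι D ⊗ x ≈ ι A ⊗ 1# ⊕ ι B ⊗ r

    -- The coordinates of D R with respect to 1 and r. As 1 and r lie in R, the pairs (D, 0) and (0,
    -- D) belong to it, so the rank is two.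
    L : ℤ → ℤ → Set _
    L A B = ∃[ x ] member x × x ∼ A , B

    ∼-sub : ∀ {x A B x′ A′ B′} → x ∼ A , B → x′ ∼ A′ , B′ → (x ⊝ x′) ∼ (A - A′) , (B - B′)
    ∼-sub {x} {A} {B} {x′} {A′} {B′} eq eq′ =
      trans (solve 3 (λ d x y → d :* (x :- y) := d :* x :- d :* y) refl (ι D) x x′)
      (trans (+-cong eq (-‿cong eq′))
      (trans (solve 6 (λ a b a′ b′ u r →
                 (a :* u :+ b :* r) :- (a′ :* u :+ b′ :* r) := (a :- a′) :* u :+ (b :- b′) :* r)
               refl (ι A) (ι B) (ι A′) (ι B′) 1# r)
        (+-cong (*-congʳ (sym (ι-sub A A′))) (*-congʳ (sym (ι-sub B B′))))))

    0∼ : 0# ∼ 0ℤ , 0ℤ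
    0∼ = trans (zeroʳ _) (sym (trans (+-cong (ι0*≈0 _) (ι0*≈0 _)) (+-identityˡ 0#)))

    isLattice : IsLattice L
    isLattice = record
      { 0-mem    = 0# , 0∈ , 0∼
      ; -‿closed = λ (x , x∈ , eq) (x′ , x′∈ , eq′) → x ⊝ x′ , +-closed x∈ (-‿closed x′∈) , ∼-sub eq eq′
      }

    D∈ : L D 0ℤ
    D∈ = 1# , 1∈ , sym (trans (+-congˡ (ι0*≈0 r)) (+-identityʳ _))

    Dr∈ : L 0ℤ D
    Dr∈ = r , r∈ , sym (trans (+-congʳ (ι0*≈0 1#)) (+-identityˡ _))

    clear-generated : ∀ {S : Pred _ ℓ₁} → (∀ {x} → S x → ∃₂ λ A B → proj₁ x ∼ A , B) →
      ∀ {x} → Generated (CommutativeRing.+-group orderRing) S x → ∃₂ λ A B → proj₁ x ∼ A , B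
    clear-generated clear-S (gen x∈S) = clear-S x∈S
    clear-generated clear-S unit = 0ℤ , 0ℤ , 0∼
    clear-generated clear-S (mult {x} {y} u v) =
      let A , B , eq = clear-generated clear-S u
          A′ , B′ , eq′ = clear-generated clear-S v
      in
      -- The sum is treated as x - (0 - y), so that `∼-sub` is the only closure property required.
      A - (0ℤ - A′) , B - (0ℤ - B′) , trans
        (*-congˡ (solve 3 (λ x y z → x :+ y := (x :- (z :- y)) :+ z) refl (proj₁ x) (proj₁ y) 0#))
        (trans (*-congˡ (+-identityʳ _)) (∼-sub eq (∼-sub 0∼ eq′)))
    clear-generated clear-S (inv u) = let A , B , eq = clear-generated clear-S u in
      0ℤ - A , 0ℤ - B , trans (*-congˡ (sym (+-identityˡ _))) (∼-sub 0∼ eq)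
    clear-generated clear-S (resp x≈y u) = let A , B , eq = clear-generated clear-S u in
      A , B , trans (*-congˡ (sym x≈y)) eq

    -- The elements of R behind the two Hermite vectors form the basis; expansions in ℤ² carry over
    -- to R by cancelling `D`. The element 1 has coordinates (D, 0), so its coefficient at `e₁`
    -- vanishes and it is an integer multiple of `e₀`.
    fromHermite : (∀ {x} → member x → ∃₂ λ A B → x ∼ A , B) → HermiteBasis L →
      ∃[ k ] ∃₂ λ e₀ e₁ → IntegralBasis e₀ e₁ × 1# ≈ ι k ⊗ e₀
    fromHermite clear H = fromBasis first second
      where
      open HermiteBasis H

      fromBasis : L (+ a) 0ℤ → L b (+ d) → ∃[ k ] ∃₂ λ e₀ e₁ → IntegralBasis e₀ e₁ × 1# ≈ ι k ⊗ e₀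
      fromBasis (e₀ , e₀∈ , e₀∼) (e₁ , e₁∈ , e₁∼) = k , e₀ , e₁ ,
        record { e₀∈ = e₀∈ ; e₁∈ = e₁∈ ; independent = independent′ ; spanning = spanning′ } , 1≈ke₀
        where
        combination∼ : ∀ i j → (ι i ⊗ e₀ ⊕ ι j ⊗ e₁) ∼ (i * + a + j * b) , (j * + d)
        combination∼ i j =
          trans (solve 5 (λ D i j x y → D :* (i :* x :+ j :* y) := i :* (D :* x) :+ j :* (D :* y))
                   refl (ι D) (ι i) (ι j) e₀ e₁)
          (trans (+-cong (*-congˡ (trans e₀∼ (trans (+-congˡ (ι0*≈0 r)) (+-identityʳ _)))) (*-congˡ e₁∼))
          (trans (solve 7 (λ i j a b d u r →
                     i :* (a :* u) :+ j :* (b :* u :+ d :* r) := (i :* a :+ j :* b) :* u :+ j :* d :* r)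
                   refl (ι i) (ι j) (ι (+ a)) (ι b) (ι (+ d)) 1# r)
            (+-cong (*-congʳ (sym (trans (ι-+ _ _) (+-cong (ι-* i (+ a)) (ι-* j b))))) (*-congʳ (sym (ι-* j (+ d)))))))

        from-coordinates : ∀ {x A B} → x ∼ A , B → ∀ i j →
          A ≡ i * + a + j * b → B ≡ j * + d → x ≈ ι i ⊗ e₀ ⊕ ι j ⊗ e₁
        from-coordinates eq i j ≡.refl ≡.refl = ι-cancel D≢0 (trans eq (sym (combination∼ i j)))

        +≢0 : ∀ n {{_ : ℕ.NonZero n}} → + n ≢ 0ℤ
        +≢0 n eq = ℕ.≢-nonZero⁻¹ n (ℤ.+-injective eq)

        independent′ : ∀ i j → ι i ⊗ e₀ ⊕ ι j ⊗ e₁ ≈ 0# → i ≡ 0ℤ × j ≡ 0ℤ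
        independent′ i j eq = i≡0 , j≡0
          where
          zeros : i * + a + j * b ≡ 0ℤ × j * + d ≡ 0ℤ
          zeros = independent _ _ (trans (sym (combination∼ i j)) (trans (*-congˡ eq) (zeroʳ _)))
          j≡0 : j ≡ 0ℤ
          j≡0 = *-cancel-≢0 (+≢0 d) (≡.trans (ℤ.*-comm (+ d) j) (proj₂ zeros))
          i≡0 : i ≡ 0ℤ
          i≡0 = *-cancel-≢0 (+≢0 a) (≡.trans (ℤ.*-comm (+ a) i) (≡.trans (≡.sym (ℤ.+-identityʳ _))
            (≡.trans (cong (λ j → i * + a + j * b) (≡.sym j≡0)) (proj₁ zeros))))

        spanning′ : ∀ {x} → member x → ∃₂ λ i j → x ≈ ι i ⊗ e₀ ⊕ ι j ⊗ e₁
        spanning′ {x} x∈ =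
          let A , B , eq = clear x∈
              i , j , A≡ , B≡ = expand (x , x∈ , eq)
          in i , j , from-coordinates eq i j A≡ B≡

        D-expansion : ∃₂ λ i j → D ≡ i * + a + j * b × 0ℤ ≡ j * + d
        D-expansion = expand D∈

        k = proj₁ D-expansion

        1≈ke₀ : 1# ≈ ι k ⊗ e₀
        1≈ke₀ =
          let _ , j , D≡ , 0≡ = D-expansion
              j≡0 = *-cancel-≢0 (+≢0 d) (≡.trans (ℤ.*-comm (+ d) j) (≡.sym 0≡))
          in trans (from-coordinates (proj₂ (proj₂ D∈)) k j D≡ 0≡)
               (trans (+-congˡ (trans (*-congʳ (trans (reflexive (cong ι j≡0)) ι-0)) (zeroˡ e₁))) (+-identityʳ _))

  integralBasis : ¬ ¬ (∃[ k ] ∃₂ λ e₀ e₁ → IntegralBasis e₀ e₁ × 1# ≈ ι k ⊗ e₀)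
  integralBasis κ =
    let r , r∈ , basis = rationalBasis-one
        _ , g , generates = finitelyGenerated
        D , D≢0 , clear-g = common-denominator basis (proj₁ ∘ g)
        clear = λ {x} x∈ → clear-generated r∈ basis D≢0
          (λ (k , y≈) → let A , B , eq = clear-g k in A , B , trans (*-congˡ y≈) eq) (generates (x , x∈))
    in hermiteBasis (isLattice r∈ basis D≢0) D≢0 (D∈ r∈ basis D≢0) (Dr∈ r∈ basis D≢0)
         (κ ∘ fromHermite r∈ basis D≢0 clear)

  -- If k e₀ = 1 and e₀² = m e₀ + n e₁, then e₀ = k e₀² gives k m = 1, so e₀ = ± 1.
  quadraticBasis : ¬ ¬ QuadraticBasis orderRing
  quadraticBasis κ = integralBasis λ (k , e₀ , e₁ , basis , 1≈ke₀) → κ (fromIntegral k e₀ e₁ basis 1≈ke₀)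
    where
    fromIntegral : ∀ k e₀ e₁ → IntegralBasis e₀ e₁ → 1# ≈ ι k ⊗ e₀ → QuadraticBasis orderRing
    fromIntegral k e₀ e₁ basis 1≈ke₀ = record
      { ι                = λ z → ι z , ι∈ z
      ; ι-isHomomorphism = ι-ring-isHomomorphism
      ; ω                = e₁ , e₁∈
      ; span             = λ (x , x∈) → let i , j , x≈ = spanning x∈ in i * m , j ,
          trans x≈ (+-congʳ (trans (*-congˡ e₀≈m) (sym (ι-* i m))))
      ; independent      = λ x y eq →
          -- Since 1 = k e₀, the integer `x` is the multiple x k of `e₀`.
          let xk≡0 , y≡0 = independent (x * k) y (trans (+-congʳ (trans (*-congʳ (ι-* x k))
                (trans (*-assoc _ _ _) (trans (*-congˡ (sym 1≈ke₀)) (*-identityʳ _))))) eq)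
          in *-cancel-≢0 k≢0 (≡.trans (ℤ.*-comm k x) xk≡0) , y≡0
      ; integral         = field-integral
      }
      where
      open IntegralBasis basis

      m n : ℤ
      m = proj₁ (spanning (*-closed e₀∈ e₀∈))
      n = proj₁ (proj₂ (spanning (*-closed e₀∈ e₀∈)))

      e₀²≈ : e₀ ⊗ e₀ ≈ ι m ⊗ e₀ ⊕ ι n ⊗ e₁
      e₀²≈ = proj₂ (proj₂ (spanning (*-closed e₀∈ e₀∈)))

      relation : ι (1ℤ - k * m) ⊗ e₀ ⊕ ι (- (k * n)) ⊗ e₁ ≈ 0#
      relation =
        trans (+-cong (*-congʳ (trans (ι-sub _ _) (+-cong ι-1 (-‿cong (ι-* k m)))))
                     (*-congʳ (trans (ι-neg _) (-‿cong (ι-* k n)))))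
        (trans (solve 6 (λ u k m n x y →
                   (u :- k :* m) :* x :+ (:- (k :* n)) :* y := u :* x :- k :* (m :* x :+ n :* y))
                 refl 1# (ι k) (ι m) (ι n) e₀ e₁)
        (trans (+-cong (*-congʳ 1≈ke₀) (-‿cong (*-congˡ (sym e₀²≈))))
        (trans (+-congʳ (*-assoc _ _ _)) (-‿inverseʳ _))))

      km≡1 : k * m ≡ 1ℤ
      km≡1 = ≡.sym (ℤ.i-j≡0⇒i≡j 1ℤ (k * m) (proj₁ (independent _ _ relation)))

      k≢0 : k ≢ 0ℤ
      k≢0 k≡0 = 1≢0 (≡.trans (≡.sym km≡1) (≡.trans (cong (_* m) k≡0) (ℤ.*-zeroˡ m)))
        where
        1≢0 : 1ℤ ≢ 0ℤ
        1≢0 ()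

      e₀≈m : e₀ ≈ ι m
      e₀≈m = trans (sym (*-identityˡ e₀))
        (trans (*-congʳ (trans (sym ι-1) (trans (reflexive (cong ι (≡.sym km≡1))) (ι-* k m))))
        (trans (solve 3 (λ k m x → k :* m :* x := m :* (k :* x)) refl (ι k) (ι m) e₀)
        (trans (*-congˡ (sym 1≈ke₀)) (*-identityʳ (ι m)))))

-- Three fields are negations and the fourth is a decidable inequality. This permits the use of a
-- basis of the order that exists only in the double-negated sense.
normInequality-stable : {R : CommutativeRing c ℓ} {I : Ideal R ℓ₁} {J : Ideal R ℓ₂} →
  ¬ ¬ NormInequality I J → NormInequality I J
normInequality-stable ¬¬ineq = record
  { finiteˡ = λ k → ¬¬ineq λ ineq → NormInequality.finiteˡ ineq k
  ; finiteʳ = λ k → ¬¬ineq λ ineq → NormInequality.finiteʳ ineq k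
  ; finite· = λ k → ¬¬ineq λ ineq → NormInequality.finite· ineq k
  ; bound   = λ {l} {m} {n} f g h → decidable-stable (l ℕ.* m ℕ.≤? n) λ k →
      ¬¬ineq λ ineq → k (NormInequality.bound ineq f g h)
  }

theorem3p3 : ∀ {c ℓ ℓ′ p i j} (K : QuadraticField c ℓ ℓ′) (R : Order K p) →
    SuperMultiplicative (Order.orderRing R) i j
    × (∀ (I : Ideal (Order.orderRing R) i) (J : Ideal (Order.orderRing R) j) →
    NonZeroIdeal I → NonZeroIdeal J → NormInequality I J)
theorem3p3 K R =
  -- Finite index of the product forces both ideals to be nonzero, which reduces
  -- super-multiplicativity to the inequality for nonzero ideals.
  (λ I J finite → normInequality-stable λ k → OrderProperties.quadraticBasis K R λ B →
    let I≢0 , J≢0 = Quadratic.finiteIndex⇒nonZero B I J finite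
    in k (Quadratic.normInequality B I J I≢0 J≢0)) ,
  (λ I J I≢0 J≢0 → normInequality-stable λ k → OrderProperties.quadraticBasis K R λ B →
    k (Quadratic.normInequality B I J I≢0 J≢0))
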